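{- (i) There is no elliptic curve defined over $\mathbb{Q}$ having a Weierstrass equation with rational coefficients on which there is a simultaneous arithmetic progression of length $7$ consisting of points of $E(\mathbb{Q})$. (ii) Up to isomorphism over $\mathbb{Q}$, there are only finitely many elliptic curves $E$ over $\mathbb{Q}$ having a Weierstrass equation with rational coefficients on which there is a simultaneous arithmetic progression of length $6$ consisting of points of $E(\mathbb{Q})$.
   Context: A Weierstrass equation over $\mathbb{Q}$ is $Y^2+a_1XY+a_3Y=X^3+a_2X^2+a_4X+a_6$ with $a_i\in\mathbb{Q}$ (nonsingular). Points $P_0=(x_0,y_0),\dots,P_n=(x_n,y_n)$ on such an equation form a simultaneous arithmetic progression (s.a.p.) of length $n+1$ if (a) $x_0,\dots,x_n$ is an arithmetic progression with nonzero common difference, and (b) there is a permutation $\sigma$ of $\{0,\dots,n\}$ such that $y_{\sigma(0)},\dots,y_{\sigma(n)}$ is an arithmetic progression. The condition (b) depends on the particular Weierstrass equation chosen, so "a curve has a s.a.p." means that some Weierstrass equation of it does. -}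

module Defs where

open import Data.Nat using (ℕ; suc)
open import Data.Integer using (+_)
open import Data.Rational using (ℚ; 0ℚ; _+_; _*_; _-_; _/_)
open import Data.Fin using (Fin; toℕ)
open import Data.Fin.Permutation using (Permutation′; _⟨$⟩ʳ_)
open import Data.Product using (Σ; _×_; ∃)
open import Data.List using (List)
open import Data.List.Membership.Propositional using (_∈_)
open import Relation.Binary.PropositionalEquality using (_≡_; _≢_)

-- A Weierstrass equation Y^2 + a1 XY + a3 Y = X^3 + a2 X^2 + a4 X + a6 over ℚ
record WEq : Set where
  constructor weq
  field
    a₁ a₂ a₃ a₄ a₆ : ℚ
open WEq public

b₂ b₄ b₆ b₈ Δ : WEq → ℚ
b₂ E = a₁ E * a₁ E + (+ 4 / 1) * a₂ E
b₄ E = (+ 2 / 1) * a₄ E + a₁ E * a₃ E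
b₆ E = a₃ E * a₃ E + (+ 4 / 1) * a₆ E
b₈ E = a₁ E * a₁ E * a₆ E + (+ 4 / 1) * a₂ E * a₆ E - a₁ E * a₃ E * a₄ E
       + a₂ E * a₃ E * a₃ E - a₄ E * a₄ E
Δ E = (0ℚ - b₂ E * b₂ E * b₈ E) - (+ 8 / 1) * b₄ E * b₄ E * b₄ E
      - (+ 27 / 1) * b₆ E * b₆ E + (+ 9 / 1) * b₂ E * b₄ E * b₆ E

Nonsingular : WEq → Set
Nonsingular E = Δ E ≢ 0ℚ

OnCurve : WEq → ℚ → ℚ → Set
OnCurve E x y =
  y * y + a₁ E * x * y + a₃ E * y
    ≡ x * x * x + a₂ E * x * x + a₄ E * x + a₆ E

idx : ∀ {n} → Fin n → ℚ
idx i = + toℕ i / 1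

-- Points P_0..P_n (given by coordinate functions xs, ys on Fin (n+1))
-- form a simultaneous arithmetic progression of length n+1 on E
IsSAP : (E : WEq) (n : ℕ) → (Fin (suc n) → ℚ) → (Fin (suc n) → ℚ) → Set
IsSAP E n xs ys =
  ((i : Fin (suc n)) → OnCurve E (xs i) (ys i))
  × (Σ ℚ λ x₀ → Σ ℚ λ d → d ≢ 0ℚ × ((i : Fin (suc n)) → xs i ≡ x₀ + idx i * d))
  × (Σ (Permutation′ (suc n)) λ σ → Σ ℚ λ y₀ → Σ ℚ λ e →
       (i : Fin (suc n)) → ys (σ ⟨$⟩ʳ i) ≡ y₀ + idx i * e)

HasSAP : WEq → ℕ → Set
HasSAP E n = Σ (Fin (suc n) → ℚ) λ xs → Σ (Fin (suc n) → ℚ) λ ys → IsSAP E n xs ys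

-- Isomorphism over ℚ of Weierstrass equations: admissible change of variables
-- X = u^2 X' + r, Y = u^3 Y' + s u^2 X' + t with u ≠ 0 (Silverman III.1)
Isomorphic : WEq → WEq → Set
Isomorphic E E' = Σ ℚ λ u → Σ ℚ λ r → Σ ℚ λ s → Σ ℚ λ t →
  u ≢ 0ℚ
  × (u * a₁ E' ≡ a₁ E + (+ 2 / 1) * s)
  × (u * u * a₂ E' ≡ a₂ E - s * a₁ E + (+ 3 / 1) * r - s * s)
  × (u * u * u * a₃ E' ≡ a₃ E + r * a₁ E + (+ 2 / 1) * t)
  × (u * u * u * u * a₄ E' ≡ a₄ E - s * a₃ E + (+ 2 / 1) * r * a₂ E
       - (t + r * s) * a₁ E + (+ 3 / 1) * r * r - (+ 2 / 1) * s * t)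
  × (u * u * u * u * u * u * a₆ E' ≡ a₆ E + r * a₄ E + r * r * a₂ E + r * r * r
       - t * a₃ E - t * t - r * t * a₁ E)

{-# OPTIONS --safe #-}
-- Write the points as (x₀ + i d, y₀ + τ(i) e) with τ a permutation of 0, …, n.
-- Pulling the equation back to the integer points (i, τ(i)) gives a cubic
-- A y² + B x y + C y = K x³ + L x² + M x + N with A = e² and K = d³ ≠ 0, and
-- third differences along i eliminate L, M, N: they leave equations
-- A P + B Q + C R = 6 K with integer P, Q, R depending only on τ.
--
-- For seven points the four equations are incompatible with A ≠ 0 ≠ K, for each
-- of the 5040 permutations.  For six points the three equations either force
-- K = 0 or determine B/A, C/A and K/A by Cramer's rule, hence also L/A, M/A and
-- N/A.  Up to the change of variables with u = e/d, the Weierstrass equation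
-- depends on these ratios only, so each permutation contributes at most one curve.
module Submission where

open import Defs
open import Algebra.Bundles using (RawRing)
import Algebra.Solver.Ring
open import Algebra.Solver.Ring.AlmostCommutativeRing using (fromCommutativeRing; _-Raw-AlmostCommutative⟶_)
open import Data.Fin using (Fin; zero; suc; toℕ)
open import Data.Fin.Patterns using (0F; 1F; 2F; 3F; 4F; 5F; 6F)
open import Data.Fin.Permutation using (_⟨$⟩ʳ_; _⟨$⟩ˡ_; inverseʳ)
open import Data.Fin.Properties using (suc-injective; toℕ-injective; toℕ<n)
open import Data.Integer as ℤ using (ℤ; +_; 0ℤ; 1ℤ)
import Data.Integer.Properties as ℤ
open import Data.List using (List; []; _∷_; concatMap; map; filter; upTo)
open import Data.List.Membership.Propositional using (_∈_; lose)
open import Data.List.Membership.Propositional.Properties using (∈-concatMap⁺; ∈-filter⁺; ∈-map⁺; ∈-upTo⁺)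
open import Data.List.Relation.Unary.All as All using (All; all?)
open import Data.List.Relation.Unary.Any using (here)
import Data.Maybe as Maybe
open import Data.Nat using (ℕ; zero; suc)
open import Data.Product using (_×_; Σ; _,_)
open import Data.Sum using (_⊎_; inj₁; inj₂)
open import Data.Vec using (Vec; []; _∷_; tabulate)
open import Function using (_∘_)
open import Level using (0ℓ)
open import Relation.Binary.Consequences using (dec⇒weaklyDec)
open import Relation.Binary.Definitions using (DecidableEquality)
open import Relation.Binary.PropositionalEquality using (_≡_; _≢_; refl; sym; trans; cong; cong₂; subst; subst₂; module ≡-Reasoning)
open import Relation.Nullary using (¬_; Dec; yes; no; ¬?; _⊎-dec_; _×-dec_; contradiction)
open import Relation.Nullary.Decidable using (toWitness)

-- Enumeration of injective sequences

module _ {A : Set} (_≟_ : DecidableEquality A) where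

  arrangements : ∀ k → List A → List (Vec A k)
  arrangements zero    xs = [] ∷ []
  arrangements (suc k) xs =
    concatMap (λ x → map (x ∷_) (arrangements k (filter (λ y → ¬? (y ≟ x)) xs))) xs

  -- By injectivity the later values differ from `f zero`, so they survive the filter and the
  -- induction applies to the tail.
  ∈-arrangements : ∀ k {xs} (f : Fin k → A) → (∀ {i j} → f i ≡ f j → i ≡ j) →
                   (∀ i → f i ∈ xs) → tabulate f ∈ arrangements k xs
  ∈-arrangements zero    f inj f∈ = here refl
  ∈-arrangements (suc k) f inj f∈ = ∈-concatMap⁺ _ (lose (f∈ zero) (∈-map⁺ (f zero ∷_)
    (∈-arrangements k (f ∘ suc) (suc-injective ∘ inj)
      λ i → ∈-filter⁺ (λ y → ¬? (y ≟ f zero)) (f∈ (suc i)) λ eq → contradiction (inj eq) λ ())))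

-- Third differences and determinants over an arbitrary ring

-- The coefficients (P, Q, R) of an equation A P + B Q + C R = k.
record Row (A : Set) : Set where
  constructor row
  field P Q R : A

-- One set of formulas serves four carriers: ℤ for decidable checks, ℚ for the actual equations,
-- solver syntax for ring identities, and the graph of `ι` to link the first two.
module Elimination (𝓡 : RawRing 0ℓ 0ℓ) where
  open RawRing 𝓡

  -- The third difference d - 3 c + 3 b - a, spelled with additions because a raw ring has no
  -- numeral 3.
  Δ³ : Carrier → Carrier → Carrier → Carrier → Carrier
  Δ³ a b c d = (d + - a) + ((b + - c) + ((b + - c) + (b + - c)))

  differences : Carrier → Carrier → Carrier → Carrier → Carrier → Row Carrier
  differences x y₀ y₁ y₂ y₃ = row
    (Δ³ (y₀ * y₀) (y₁ * y₁) (y₂ * y₂) (y₃ * y₃))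
    (Δ³ (x * y₀) ((x + 1#) * y₁) (((x + 1#) + 1#) * y₂) ((((x + 1#) + 1#) + 1#) * y₃))
    (Δ³ y₀ y₁ y₂ y₃)

  det : Row Carrier → Row Carrier → Row Carrier → Carrier
  det (row a b c) (row d e f) (row g h i) =
    (a * (e * i + - (f * h)) + b * (f * g + - (d * i))) + c * (d * h + - (e * g))

  infixl 6 _⊖_
  _⊖_ : Row Carrier → Row Carrier → Row Carrier
  row a b c ⊖ row d e f = row (a + - d) (b + - e) (c + - f)

  P≔1 Q≔1 R≔1 : Row Carrier → Row Carrier
  P≔1 (row a b c) = row 1# b c
  Q≔1 (row a b c) = row a 1# c
  R≔1 (row a b c) = row a b 1#

  -- The determinants of Cramer's rule when all right-hand sides equal k: a column of ones replaces
  -- the P, Q or R column.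
  detₖ det-B det-C : Row Carrier → Row Carrier → Row Carrier → Carrier
  detₖ  r s t = det (P≔1 r) (P≔1 s) (P≔1 t)
  det-B r s t = det (Q≔1 r) (Q≔1 s) (Q≔1 t)
  det-C r s t = det (R≔1 r) (R≔1 s) (R≔1 t)

open import Data.Rational using (ℚ; 0ℚ; 1ℚ; _+_; _*_; _-_; -_; _/_; 1/_; toℚᵘ; ≢-nonZero)
import Data.Rational.Properties as ℚ
import Data.Rational.Unnormalised as ℚᵘ
import Data.Rational.Unnormalised.Properties as ℚᵘ

-- Integers inside the rationals

ι : ℤ → ℚ
ι z = z / 1

toℚᵘ-ι : ∀ z → toℚᵘ (ι z) ℚᵘ.≃ ℚᵘ.mkℚᵘ z 0
toℚᵘ-ι z = ℚ.toℚᵘ-fromℚᵘ (ℚᵘ.mkℚᵘ z 0)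

ι-injective : ∀ {a b} → ι a ≡ ι b → a ≡ b
ι-injective {a} {b} eq with ℚᵘ.≃-trans (ℚᵘ.≃-sym (toℚᵘ-ι a)) (ℚᵘ.≃-trans (ℚ.toℚᵘ-cong eq) (toℚᵘ-ι b))
... | ℚᵘ.*≡* e = trans (sym (ℤ.*-identityʳ a)) (trans e (ℤ.*-identityʳ b))

ι-+ : ∀ a b → ι (a ℤ.+ b) ≡ ι a + ι b
ι-+ a b = ℚ.toℚᵘ-injective (begin
  toℚᵘ (ι (a ℤ.+ b))           ≈⟨ toℚᵘ-ι (a ℤ.+ b) ⟩
  ℚᵘ.mkℚᵘ (a ℤ.+ b) 0          ≈⟨ ℚᵘ.*≡* (cong (ℤ._* 1ℤ) (sym (cong₂ ℤ._+_ (ℤ.*-identityʳ a) (ℤ.*-identityʳ b)))) ⟩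
  ℚᵘ.mkℚᵘ a 0 ℚᵘ.+ ℚᵘ.mkℚᵘ b 0 ≈⟨ ℚᵘ.+-cong (toℚᵘ-ι a) (toℚᵘ-ι b) ⟨
  toℚᵘ (ι a) ℚᵘ.+ toℚᵘ (ι b)   ≈⟨ ℚ.toℚᵘ-homo-+ (ι a) (ι b) ⟨
  toℚᵘ (ι a + ι b)             ∎)
  where open import Relation.Binary.Reasoning.Setoid ℚᵘ.≃-setoid

ι-* : ∀ a b → ι (a ℤ.* b) ≡ ι a * ι b
ι-* a b = ℚ.toℚᵘ-injective (begin
  toℚᵘ (ι (a ℤ.* b))           ≈⟨ toℚᵘ-ι (a ℤ.* b) ⟩
  ℚᵘ.mkℚᵘ a 0 ℚᵘ.* ℚᵘ.mkℚᵘ b 0 ≈⟨ ℚᵘ.*-cong (toℚᵘ-ι a) (toℚᵘ-ι b) ⟨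
  toℚᵘ (ι a) ℚᵘ.* toℚᵘ (ι b)   ≈⟨ ℚ.toℚᵘ-homo-* (ι a) (ι b) ⟨
  toℚᵘ (ι a * ι b)             ∎)
  where open import Relation.Binary.Reasoning.Setoid ℚᵘ.≃-setoid

ι-neg : ∀ a → ι (ℤ.- a) ≡ - ι a
ι-neg a = ℚ.toℚᵘ-injective (begin
  toℚᵘ (ι (ℤ.- a)) ≈⟨ toℚᵘ-ι (ℤ.- a) ⟩
  ℚᵘ.- ℚᵘ.mkℚᵘ a 0 ≈⟨ ℚᵘ.-‿cong (toℚᵘ-ι a) ⟨
  ℚᵘ.- toℚᵘ (ι a)  ≈⟨ ℚ.toℚᵘ-homo‿- (ι a) ⟨
  toℚᵘ (- ι a)     ∎)
  where open import Relation.Binary.Reasoning.Setoid ℚᵘ.≃-setoid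

ι-morphism : ℤ.+-*-rawRing -Raw-AlmostCommutative⟶ fromCommutativeRing ℚ.+-*-commutativeRing
ι-morphism = record
  { ⟦_⟧ = ι ; +-homo = ι-+ ; *-homo = ι-* ; -‿homo = ι-neg ; 0-homo = refl ; 1-homo = refl }

open Algebra.Solver.Ring ℤ.+-*-rawRing (fromCommutativeRing ℚ.+-*-commutativeRing) ι-morphism
  (λ a b → Maybe.map (cong ι) (dec⇒weaklyDec ℤ._≟_ a b))
  using (Polynomial; con; solve; _:+_; _:*_; _:-_; :-_; _:=_)

-- Division in the rationals

infix 8 _⁻¹
-- The default value 0 makes inversion total, so that `interpolate` is defined even where `detₖ` is
-- zero.
_⁻¹ : ℚ → ℚ
p ⁻¹ with p ℚ.≟ 0ℚ
... | yes _   = 0ℚ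
... | no p≢0 = (1/ p) {{≢-nonZero p≢0}}

⁻¹-inverseˡ : ∀ {p} → p ≢ 0ℚ → p ⁻¹ * p ≡ 1ℚ
⁻¹-inverseˡ {p} p≢0 with p ℚ.≟ 0ℚ
... | yes p≡0 = contradiction p≡0 p≢0
... | no p≢0′ = ℚ.*-inverseˡ p {{≢-nonZero p≢0′}}

divide : ∀ {p q r} → p ≢ 0ℚ → r ≡ q * p → q ≡ p ⁻¹ * r
divide {p} {q} {r} p≢0 r≡qp = sym (begin
  p ⁻¹ * r       ≡⟨ cong (p ⁻¹ *_) r≡qp ⟩
  p ⁻¹ * (q * p) ≡⟨ solve 3 (λ i p q → i :* (q :* p) := (i :* p) :* q) refl (p ⁻¹) p q ⟩
  (p ⁻¹ * p) * q ≡⟨ cong (_* q) (⁻¹-inverseˡ p≢0) ⟩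
  1ℚ * q         ≡⟨ ℚ.*-identityˡ q ⟩
  q              ∎)
  where open ≡-Reasoning

p≢0∧qp≡0⇒q≡0 : ∀ {p q} → p ≢ 0ℚ → q * p ≡ 0ℚ → q ≡ 0ℚ
p≢0∧qp≡0⇒q≡0 {p} p≢0 qp≡0 = trans (divide p≢0 (sym qp≡0)) (ℚ.*-zeroʳ (p ⁻¹))

*-≢0 : ∀ {p q} → p ≢ 0ℚ → q ≢ 0ℚ → p * q ≢ 0ℚ
*-≢0 p≢0 q≢0 pq≡0 = p≢0 (p≢0∧qp≡0⇒q≡0 q≢0 pq≡0)

ι-≢0 : ∀ {z} → z ≢ 0ℤ → ι z ≢ 0ℚ
ι-≢0 z≢0 ιz≡0 = z≢0 (ι-injective ιz≡0)

-- Transfer of the elimination formulas from ℤ to ℚ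

open Elimination ℤ.+-*-rawRing
module Elimℚ = Elimination ℚ.+-*-rawRing

-- The polynomial expressions of Elimination commute with ι: evaluating them in
-- the graph of ι returns the integer value, the rational value and the proof.
record Graph : Set where
  field
    int : ℤ
    rat : ℚ
    ι≡  : ι int ≡ rat
open Graph

graph : ℤ → Graph
graph z = record { int = z ; rat = ι z ; ι≡ = refl }

graphRing : RawRing 0ℓ 0ℓ
graphRing = record
  { Carrier = Graph
  ; _≈_ = _≡_
  ; _+_ = λ a b → record { int = int a ℤ.+ int b ; rat = rat a + rat b
                         ; ι≡ = trans (ι-+ (int a) (int b)) (cong₂ _+_ (ι≡ a) (ι≡ b)) }
  ; _*_ = λ a b → record { int = int a ℤ.* int b ; rat = rat a * rat b
                         ; ι≡ = trans (ι-* (int a) (int b)) (cong₂ _*_ (ι≡ a) (ι≡ b)) }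
  ; -_  = λ a → record { int = ℤ.- int a ; rat = - rat a
                       ; ι≡ = trans (ι-neg (int a)) (cong -_ (ι≡ a)) }
  ; 0#  = graph 0ℤ
  ; 1#  = graph 1ℤ
  }
module ElimGraph = Elimination graphRing

mapRow : ∀ {A B : Set} → (A → B) → Row A → Row B
mapRow f (row a b c) = row (f a) (f b) (f c)

row-cong : ∀ {A : Set} {a a′ b b′ c c′ : A} → a ≡ a′ → b ≡ b′ → c ≡ c′ → row a b c ≡ row a′ b′ c′
row-cong refl refl refl = refl

ι-det : ∀ r s t → ι (det r s t) ≡ Elimℚ.det (mapRow ι r) (mapRow ι s) (mapRow ι t)
ι-det r s t = ι≡ (ElimGraph.det (mapRow graph r) (mapRow graph s) (mapRow graph t))

ι-⊖ : ∀ r s → mapRow ι (r ⊖ s) ≡ mapRow ι r Elimℚ.⊖ mapRow ι s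
ι-⊖ (row a b c) (row d e f) = row-cong (ι-minus a d) (ι-minus b e) (ι-minus c f)
  where
  ι-minus : ∀ a b → ι (a ℤ.+ ℤ.- b) ≡ ι a + - ι b
  ι-minus a b = trans (ι-+ a (ℤ.- b)) (cong (λ z → ι a + z) (ι-neg b))

ι-differences : ∀ x y₀ y₁ y₂ y₃ →
  mapRow ι (differences x y₀ y₁ y₂ y₃) ≡ Elimℚ.differences (ι x) (ι y₀) (ι y₁) (ι y₂) (ι y₃)
ι-differences x y₀ y₁ y₂ y₃ = row-cong (ι≡ (Row.P r)) (ι≡ (Row.Q r)) (ι≡ (Row.R r))
  where r = ElimGraph.differences (graph x) (graph y₀) (graph y₁) (graph y₂) (graph y₃)

-- Linear equations between A, B, C and k

record Equation (A B C k : ℚ) (r : Row ℚ) : Set where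
  constructor equation
  field holds : A * Row.P r + B * Row.Q r + C * Row.R r ≡ k

p≡q⇒p-q≡0 : ∀ {p q} → p ≡ q → p - q ≡ 0ℚ
p≡q⇒p-q≡0 {p} refl = ℚ.+-inverseʳ p

polynomialRing : ℕ → RawRing 0ℓ 0ℓ
polynomialRing n = record
  { Carrier = Polynomial n ; _≈_ = _≡_ ; _+_ = _:+_ ; _*_ = _:*_ ; -_ = :-_
  ; 0# = con 0ℤ ; 1# = con 1ℤ }
module ElimPoly {n} = Elimination (polynomialRing n)

-- Turns a deduction from three equations u = v = w = 0 into one ring identity, which the solver can
-- check.
defects-vanish : ∀ {a b u v w} p q r → a ≡ b + (p * u + q * v + r * w) →
                 u ≡ 0ℚ → v ≡ 0ℚ → w ≡ 0ℚ → a ≡ b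
defects-vanish {b = b} p q r a≡ refl refl refl = trans a≡
  (solve 4 (λ b p q r → b :+ (p :* con 0ℤ :+ q :* con 0ℤ :+ r :* con 0ℤ) := b) refl b p q r)

-- In Cramer's rule the difference of the two sides is a combination of the
-- defects A P + B Q + C R - k, weighted by cofactors.
module _ {A B C k : ℚ} where

  cramer-k : ∀ r s t → Equation A B C k r → Equation A B C k s → Equation A B C k t →
             A * Elimℚ.det r s t ≡ k * Elimℚ.detₖ r s t
  cramer-k (row P₀ Q₀ R₀) (row P₁ Q₁ R₁) (row P₂ Q₂ R₂) (equation eq₀) (equation eq₁) (equation eq₂) = defects-vanish
    (Q₁ * R₂ - R₁ * Q₂) (Q₂ * R₀ - R₂ * Q₀) (Q₀ * R₁ - R₀ * Q₁)
    (solve 13 (λ A B C k P₀ Q₀ R₀ P₁ Q₁ R₁ P₂ Q₂ R₂ →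
      let r = row P₀ Q₀ R₀ ; s = row P₁ Q₁ R₁ ; t = row P₂ Q₂ R₂ in
      A :* ElimPoly.det r s t := k :* ElimPoly.detₖ r s t :+
        ((Q₁ :* R₂ :- R₁ :* Q₂) :* (A :* P₀ :+ B :* Q₀ :+ C :* R₀ :- k)
          :+ (Q₂ :* R₀ :- R₂ :* Q₀) :* (A :* P₁ :+ B :* Q₁ :+ C :* R₁ :- k)
          :+ (Q₀ :* R₁ :- R₀ :* Q₁) :* (A :* P₂ :+ B :* Q₂ :+ C :* R₂ :- k)))
      refl A B C k P₀ Q₀ R₀ P₁ Q₁ R₁ P₂ Q₂ R₂)
    (p≡q⇒p-q≡0 eq₀) (p≡q⇒p-q≡0 eq₁) (p≡q⇒p-q≡0 eq₂)

  -- The weights sum to zero, so k cancels; B/A is thus fixed by the rows alone once `detₖ` is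
  -- nonzero. The same happens for C/A in `cramer-C`.
  cramer-B : ∀ r s t → Equation A B C k r → Equation A B C k s → Equation A B C k t →
             A * Elimℚ.det-B r s t ≡ B * Elimℚ.detₖ r s t
  cramer-B (row P₀ Q₀ R₀) (row P₁ Q₁ R₁) (row P₂ Q₂ R₂) (equation eq₀) (equation eq₁) (equation eq₂) = defects-vanish
    (R₂ - R₁) (R₀ - R₂) (R₁ - R₀)
    (solve 13 (λ A B C k P₀ Q₀ R₀ P₁ Q₁ R₁ P₂ Q₂ R₂ →
      let r = row P₀ Q₀ R₀ ; s = row P₁ Q₁ R₁ ; t = row P₂ Q₂ R₂ in
      A :* ElimPoly.det-B r s t := B :* ElimPoly.detₖ r s t :+
        ((R₂ :- R₁) :* (A :* P₀ :+ B :* Q₀ :+ C :* R₀ :- k)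
          :+ (R₀ :- R₂) :* (A :* P₁ :+ B :* Q₁ :+ C :* R₁ :- k)
          :+ (R₁ :- R₀) :* (A :* P₂ :+ B :* Q₂ :+ C :* R₂ :- k)))
      refl A B C k P₀ Q₀ R₀ P₁ Q₁ R₁ P₂ Q₂ R₂)
    (p≡q⇒p-q≡0 eq₀) (p≡q⇒p-q≡0 eq₁) (p≡q⇒p-q≡0 eq₂)

  cramer-C : ∀ r s t → Equation A B C k r → Equation A B C k s → Equation A B C k t →
             A * Elimℚ.det-C r s t ≡ C * Elimℚ.detₖ r s t
  cramer-C (row P₀ Q₀ R₀) (row P₁ Q₁ R₁) (row P₂ Q₂ R₂) (equation eq₀) (equation eq₁) (equation eq₂) = defects-vanish
    (Q₁ - Q₂) (Q₂ - Q₀) (Q₀ - Q₁)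
    (solve 13 (λ A B C k P₀ Q₀ R₀ P₁ Q₁ R₁ P₂ Q₂ R₂ →
      let r = row P₀ Q₀ R₀ ; s = row P₁ Q₁ R₁ ; t = row P₂ Q₂ R₂ in
      A :* ElimPoly.det-C r s t := C :* ElimPoly.detₖ r s t :+
        ((Q₁ :- Q₂) :* (A :* P₀ :+ B :* Q₀ :+ C :* R₀ :- k)
          :+ (Q₂ :- Q₀) :* (A :* P₁ :+ B :* Q₁ :+ C :* R₁ :- k)
          :+ (Q₀ :- Q₁) :* (A :* P₂ :+ B :* Q₂ :+ C :* R₂ :- k)))
      refl A B C k P₀ Q₀ R₀ P₁ Q₁ R₁ P₂ Q₂ R₂)
    (p≡q⇒p-q≡0 eq₀) (p≡q⇒p-q≡0 eq₁) (p≡q⇒p-q≡0 eq₂)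

  subtract : ∀ r s → Equation A B C k r → Equation A B C k s → Equation A B C 0ℚ (r Elimℚ.⊖ s)
  subtract (row P₀ Q₀ R₀) (row P₁ Q₁ R₁) (equation eq₀) (equation eq₁) = equation (trans
    (solve 9 (λ A B C P₀ Q₀ R₀ P₁ Q₁ R₁ →
      A :* (P₀ :+ :- P₁) :+ B :* (Q₀ :+ :- Q₁) :+ C :* (R₀ :+ :- R₁)
      := (A :* P₀ :+ B :* Q₀ :+ C :* R₀) :- (A :* P₁ :+ B :* Q₁ :+ C :* R₁))
      refl A B C P₀ Q₀ R₀ P₁ Q₁ R₁)
    (p≡q⇒p-q≡0 (trans eq₀ (sym eq₁))))

-- Incompatible systems of four equations

Vanishing : Row ℤ → Set
Vanishing (row P Q R) = P ≡ 0ℤ × Q ≡ 0ℤ × R ≡ 0ℤ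

vanishing? : ∀ r → Dec (Vanishing r)
vanishing? (row P Q R) = P ℤ.≟ 0ℤ ×-dec Q ℤ.≟ 0ℤ ×-dec R ℤ.≟ 0ℤ

vanishing⇒k≡0 : ∀ {A B C k} r → Vanishing r → Equation A B C k (mapRow ι r) → k ≡ 0ℚ
vanishing⇒k≡0 {A} {B} {C} r (refl , refl , refl) (equation eq) = trans (sym eq)
  (solve 3 (λ A B C → A :* con 0ℤ :+ B :* con 0ℤ :+ C :* con 0ℤ := con 0ℤ) refl A B C)

-- Cramer's rule A det = k `detₖ` then forces k = 0.
Degenerate : Row ℤ → Row ℤ → Row ℤ → Set
Degenerate r s t = det r s t ≡ 0ℤ × detₖ r s t ≢ 0ℤ

degenerate? : ∀ r s t → Dec (Degenerate r s t)
degenerate? r s t = (det r s t ℤ.≟ 0ℤ) ×-dec ¬? (detₖ r s t ℤ.≟ 0ℤ)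

-- A decidable certificate of three kinds: the differences of rows form an invertible homogeneous
-- system, forcing A = 0; or a zero row, or a degenerate triple, forces k = 0.
Obstructed : Row ℤ → Row ℤ → Row ℤ → Row ℤ → Set
Obstructed r s t u =
  det (s ⊖ r) (t ⊖ r) (u ⊖ r) ≢ 0ℤ
  ⊎ (Vanishing r ⊎ Vanishing s ⊎ Vanishing t ⊎ Vanishing u)
  ⊎ (Degenerate r s t ⊎ Degenerate r s u ⊎ Degenerate r t u ⊎ Degenerate s t u)

obstructed? : ∀ r s t u → Dec (Obstructed r s t u)
obstructed? r s t u =
  ¬? (det (s ⊖ r) (t ⊖ r) (u ⊖ r) ℤ.≟ 0ℤ)
  ⊎-dec (vanishing? r ⊎-dec vanishing? s ⊎-dec vanishing? t ⊎-dec vanishing? u)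
  ⊎-dec (degenerate? r s t ⊎-dec degenerate? r s u ⊎-dec degenerate? r t u ⊎-dec degenerate? s t u)

module _ {A B C k : ℚ} where

  private
    _Holds : Row ℤ → Set
    r Holds = Equation A B C k (mapRow ι r)

  ι-cramer-k : ∀ r s t → r Holds → s Holds → t Holds → A * ι (det r s t) ≡ k * ι (detₖ r s t)
  ι-cramer-k r s t hr hs ht =
    subst₂ (λ p q → A * p ≡ k * q) (sym (ι-det r s t)) (sym (ι-det (P≔1 r) (P≔1 s) (P≔1 t)))
      (cramer-k (mapRow ι r) (mapRow ι s) (mapRow ι t) hr hs ht)

  ι-cramer-B : ∀ r s t → r Holds → s Holds → t Holds → A * ι (det-B r s t) ≡ B * ι (detₖ r s t)
  ι-cramer-B r s t hr hs ht =
    subst₂ (λ p q → A * p ≡ B * q) (sym (ι-det (Q≔1 r) (Q≔1 s) (Q≔1 t))) (sym (ι-det (P≔1 r) (P≔1 s) (P≔1 t)))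
      (cramer-B (mapRow ι r) (mapRow ι s) (mapRow ι t) hr hs ht)

  ι-cramer-C : ∀ r s t → r Holds → s Holds → t Holds → A * ι (det-C r s t) ≡ C * ι (detₖ r s t)
  ι-cramer-C r s t hr hs ht =
    subst₂ (λ p q → A * p ≡ C * q) (sym (ι-det (R≔1 r) (R≔1 s) (R≔1 t))) (sym (ι-det (P≔1 r) (P≔1 s) (P≔1 t)))
      (cramer-C (mapRow ι r) (mapRow ι s) (mapRow ι t) hr hs ht)

  degenerate⇒k≡0 : ∀ r s t → Degenerate r s t → r Holds → s Holds → t Holds → k ≡ 0ℚ
  degenerate⇒k≡0 r s t (det≡0 , detₖ≢0) hr hs ht = p≢0∧qp≡0⇒q≡0 (ι-≢0 detₖ≢0)
    (trans (sym (ι-cramer-k r s t hr hs ht)) (trans (cong (λ z → A * ι z) det≡0) (ℚ.*-zeroʳ A)))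

ι-subtract : ∀ {A B C k} r s → Equation A B C k (mapRow ι r) → Equation A B C k (mapRow ι s) →
             Equation A B C 0ℚ (mapRow ι (r ⊖ s))
ι-subtract {A} {B} {C} r s hr hs =
  subst (Equation A B C 0ℚ) (sym (ι-⊖ r s)) (subtract (mapRow ι r) (mapRow ι s) hr hs)

¬obstructed : ∀ {A B C k} → A ≢ 0ℚ → k ≢ 0ℚ → ∀ r s t u →
  Equation A B C k (mapRow ι r) → Equation A B C k (mapRow ι s) →
  Equation A B C k (mapRow ι t) → Equation A B C k (mapRow ι u) → ¬ Obstructed r s t u
¬obstructed {A} A≢0 k≢0 r s t u hr hs ht hu = λ where
  -- Subtracting the equation of `r` removes k, so Cramer's rule for the three differences reads A
  -- det = 0.
  (inj₁ det≢0) → A≢0 (p≢0∧qp≡0⇒q≡0 (ι-≢0 det≢0)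
    (trans (ι-cramer-k (s ⊖ r) (t ⊖ r) (u ⊖ r) (ι-subtract s r hs hr) (ι-subtract t r ht hr) (ι-subtract u r hu hr))
           (ℚ.*-zeroˡ (ι (detₖ (s ⊖ r) (t ⊖ r) (u ⊖ r))))))
  (inj₂ (inj₁ (inj₁ v)))                      → k≢0 (vanishing⇒k≡0 r v hr)
  (inj₂ (inj₁ (inj₂ (inj₁ v))))               → k≢0 (vanishing⇒k≡0 s v hs)
  (inj₂ (inj₁ (inj₂ (inj₂ (inj₁ v)))))        → k≢0 (vanishing⇒k≡0 t v ht)
  (inj₂ (inj₁ (inj₂ (inj₂ (inj₂ v)))))        → k≢0 (vanishing⇒k≡0 u v hu)
  (inj₂ (inj₂ (inj₁ g)))                      → k≢0 (degenerate⇒k≡0 r s t g hr hs ht)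
  (inj₂ (inj₂ (inj₂ (inj₁ g))))               → k≢0 (degenerate⇒k≡0 r s u g hr hs hu)
  (inj₂ (inj₂ (inj₂ (inj₂ (inj₁ g)))))        → k≢0 (degenerate⇒k≡0 r t u g hr ht hu)
  (inj₂ (inj₂ (inj₂ (inj₂ (inj₂ g)))))        → k≢0 (degenerate⇒k≡0 s t u g hs ht hu)

-- Cubics through integer points

-- A y² + B x y + C y = K x³ + L x² + M x + N
record Cubic : Set where
  constructor cubic
  field A B C K L M N : ℚ
open Cubic

lhs rhs : Cubic → ℚ → ℚ → ℚ
lhs c x y = A c * (y * y) + B c * (x * y) + C c * y
rhs c x y = K c * (x * x * x) + L c * (x * x) + M c * x + N c

Through : Cubic → ℚ → ℚ → Set
Through c x y = lhs c x y ≡ rhs c x y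

module _ (c : Cubic) where

  -- The third difference with step 1 annihilates 1, x and x² and sends x³ to 6; on the left it is
  -- linear in A, B, C.
  third-difference : ∀ x y₀ y₁ y₂ y₃ →
    Through c x y₀ → Through c (x + 1ℚ) y₁ → Through c (x + 1ℚ + 1ℚ) y₂ → Through c (x + 1ℚ + 1ℚ + 1ℚ) y₃ →
    Equation (A c) (B c) (C c) (ι (+ 6) * K c) (Elimℚ.differences x y₀ y₁ y₂ y₃)
  third-difference x y₀ y₁ y₂ y₃ h₀ h₁ h₂ h₃ = equation (begin
    A c * Row.P r + B c * Row.Q r + C c * Row.R r
      ≡⟨ solve 8 (λ A B C x y₀ y₁ y₂ y₃ →
           let module r = Row (ElimPoly.differences x y₀ y₁ y₂ y₃)
               f = λ x y → A :* (y :* y) :+ B :* (x :* y) :+ C :* y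
               1′ = con 1ℤ in
           A :* r.P :+ B :* r.Q :+ C :* r.R
           := ElimPoly.Δ³ (f x y₀) (f (x :+ 1′) y₁) (f (x :+ 1′ :+ 1′) y₂) (f (x :+ 1′ :+ 1′ :+ 1′) y₃))
           refl (A c) (B c) (C c) x y₀ y₁ y₂ y₃ ⟩
    Elimℚ.Δ³ (lhs c x y₀) (lhs c (x + 1ℚ) y₁) (lhs c (x + 1ℚ + 1ℚ) y₂) (lhs c (x + 1ℚ + 1ℚ + 1ℚ) y₃)
      ≡⟨ Δ³-cong h₀ h₁ h₂ h₃ ⟩
    Elimℚ.Δ³ (rhs c x y₀) (rhs c (x + 1ℚ) y₁) (rhs c (x + 1ℚ + 1ℚ) y₂) (rhs c (x + 1ℚ + 1ℚ + 1ℚ) y₃)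
      ≡⟨ solve 5 (λ K L M N x →
           let f = λ x → K :* (x :* x :* x) :+ L :* (x :* x) :+ M :* x :+ N
               1′ = con 1ℤ in
           ElimPoly.Δ³ (f x) (f (x :+ 1′)) (f (x :+ 1′ :+ 1′)) (f (x :+ 1′ :+ 1′ :+ 1′))
           := con (+ 6) :* K)
           refl (K c) (L c) (M c) (N c) x ⟩
    ι (+ 6) * K c ∎)
    where
    open ≡-Reasoning
    r = Elimℚ.differences x y₀ y₁ y₂ y₃
    Δ³-cong : ∀ {a a′ b b′ c c′ d d′} → a ≡ a′ → b ≡ b′ → c ≡ c′ → d ≡ d′ → Elimℚ.Δ³ a b c d ≡ Elimℚ.Δ³ a′ b′ c′ d′
    Δ³-cong refl refl refl refl = refl

  ι-third-difference : ∀ x y₀ y₁ y₂ y₃ →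
    Through c (ι x) (ι y₀) → Through c (ι x + 1ℚ) (ι y₁) →
    Through c (ι x + 1ℚ + 1ℚ) (ι y₂) → Through c (ι x + 1ℚ + 1ℚ + 1ℚ) (ι y₃) →
    Equation (A c) (B c) (C c) (ι (+ 6) * K c) (mapRow ι (differences x y₀ y₁ y₂ y₃))
  ι-third-difference x y₀ y₁ y₂ y₃ h₀ h₁ h₂ h₃ =
    subst (Equation (A c) (B c) (C c) (ι (+ 6) * K c)) (sym (ι-differences x y₀ y₁ y₂ y₃))
      (third-difference (ι x) (ι y₀) (ι y₁) (ι y₂) (ι y₃) h₀ h₁ h₂ h₃)

infixr 7 _•_
_•_ : ℚ → Cubic → Cubic
t • c = cubic (t * A c) (t * B c) (t * C c) (t * K c) (t * L c) (t * M c) (t * N c)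

through-• : ∀ t c {x y} → Through c x y → Through (t • c) x y
through-• t c {x} {y} h = begin
  lhs (t • c) x y ≡⟨ solve 6 (λ t A B C x y →
    (t :* A) :* (y :* y) :+ (t :* B) :* (x :* y) :+ (t :* C) :* y
    := t :* (A :* (y :* y) :+ B :* (x :* y) :+ C :* y)) refl t (A c) (B c) (C c) x y ⟩
  t * lhs c x y   ≡⟨ cong (t *_) h ⟩
  t * rhs c x y   ≡⟨ solve 6 (λ t K L M N x →
    t :* (K :* (x :* x :* x) :+ L :* (x :* x) :+ M :* x :+ N)
    := (t :* K) :* (x :* x :* x) :+ (t :* L) :* (x :* x) :+ (t :* M) :* x :+ t :* N)
    refl t (K c) (L c) (M c) (N c) x ⟩
  rhs (t • c) x y ∎
  where open ≡-Reasoning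

-- For A = 1, the equation in the coordinates X = K x, Y = K y, multiplied by K².
weierstrass : Cubic → WEq
weierstrass c = weq (B c) (L c) (C c * K c) (M c * K c) (N c * (K c * K c))

-- The cubic with A = 1 and the given B, C, K that passes through (0, y₀), (1, y₁), (2, y₂).
completion : ℚ → ℚ → ℚ → ℚ → ℚ → ℚ → Cubic
completion B C K y₀ y₁ y₂ = cubic 1ℚ B C K ℓ (f₁ - f₀ - K - ℓ) f₀
  where
  f₀ = y₀ * y₀ + C * y₀
  f₁ = y₁ * y₁ + B * y₁ + C * y₁
  f₂ = y₂ * y₂ + B * (ι (+ 2) * y₂) + C * y₂
  -- At 0, 1, 2 the second difference of the right-hand side is 6 K + 2 L.
  ℓ = (+ 1 / 2) * (f₂ - ι (+ 2) * f₁ + f₀) - ι (+ 3) * K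

cubic-cong : ∀ {A B C K L L′ M M′ N N′} → L ≡ L′ → M ≡ M′ → N ≡ N′ →
             cubic A B C K L M N ≡ cubic A B C K L′ M′ N′
cubic-cong refl refl refl = refl

-- The value at 0 gives N, the second difference gives L, and the value at 1 then gives M.
completion-unique : ∀ c y₀ y₁ y₂ → A c ≡ 1ℚ →
  Through c (ι (+ 0)) y₀ → Through c (ι (+ 1)) y₁ → Through c (ι (+ 2)) y₂ →
  c ≡ completion (B c) (C c) (K c) y₀ y₁ y₂
completion-unique (cubic _ B C K L M N) y₀ y₁ y₂ refl h₀ h₁ h₂ = cubic-cong L≡ M≡ N≡
  where
  f₀ = y₀ * y₀ + C * y₀
  f₁ = y₁ * y₁ + B * y₁ + C * y₁
  f₂ = y₂ * y₂ + B * (ι (+ 2) * y₂) + C * y₂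
  f₀≡ : f₀ ≡ N
  f₀≡ = trans
    (solve 3 (λ B C y → y :* y :+ C :* y := con 1ℤ :* (y :* y) :+ B :* (con 0ℤ :* y) :+ C :* y) refl B C y₀)
    (trans h₀ (solve 4 (λ K L M N → K :* con 0ℤ :+ L :* con 0ℤ :+ M :* con 0ℤ :+ N := N) refl K L M N))
  f₁≡ : f₁ ≡ K + L + M + N
  f₁≡ = trans
    (solve 3 (λ B C y → y :* y :+ B :* y :+ C :* y := con 1ℤ :* (y :* y) :+ B :* (con 1ℤ :* y) :+ C :* y) refl B C y₁)
    (trans h₁ (solve 4 (λ K L M N → K :* con 1ℤ :+ L :* con 1ℤ :+ M :* con 1ℤ :+ N := K :+ L :+ M :+ N) refl K L M N))
  f₂≡ : f₂ ≡ ι (+ 8) * K + ι (+ 4) * L + ι (+ 2) * M + N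
  f₂≡ = trans
    (solve 3 (λ B C y → y :* y :+ B :* (con (+ 2) :* y) :+ C :* y
                     := con 1ℤ :* (y :* y) :+ B :* (con (+ 2) :* y) :+ C :* y) refl B C y₂)
    (trans h₂ (solve 4 (λ K L M N → K :* con (+ 8) :+ L :* con (+ 4) :+ M :* con (+ 2) :+ N
                                := con (+ 8) :* K :+ con (+ 4) :* L :+ con (+ 2) :* M :+ N) refl K L M N))
  second : ∀ {f₀′ f₁′ f₂′} → f₀ ≡ f₀′ → f₁ ≡ f₁′ → f₂ ≡ f₂′ → f₂ - ι (+ 2) * f₁ + f₀ ≡ f₂′ - ι (+ 2) * f₁′ + f₀′
  second refl refl refl = refl
  L≡ : L ≡ (+ 1 / 2) * (f₂ - ι (+ 2) * f₁ + f₀) - ι (+ 3) * K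
  L≡ = sym (begin
    (+ 1 / 2) * (f₂ - ι (+ 2) * f₁ + f₀) - ι (+ 3) * K
      ≡⟨ cong (λ z → (+ 1 / 2) * z - ι (+ 3) * K) (second f₀≡ f₁≡ f₂≡) ⟩
    (+ 1 / 2) * ((ι (+ 8) * K + ι (+ 4) * L + ι (+ 2) * M + N) - ι (+ 2) * (K + L + M + N) + N) - ι (+ 3) * K
      -- The solver has integer coefficients only, so 1/2 enters as a variable `h`; the product
      -- `h :* con (+ 2)` evaluates to 1 afterwards.
      ≡⟨ solve 5 (λ h K L M N →
           h :* ((con (+ 8) :* K :+ con (+ 4) :* L :+ con (+ 2) :* M :+ N) :- con (+ 2) :* (K :+ L :+ M :+ N) :+ N)
             :- con (+ 3) :* K
           := (h :* con (+ 2)) :* (con (+ 3) :* K :+ L) :- con (+ 3) :* K)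
           refl (+ 1 / 2) K L M N ⟩
    1ℚ * (ι (+ 3) * K + L) - ι (+ 3) * K
      ≡⟨ solve 2 (λ K L → con 1ℤ :* (con (+ 3) :* K :+ L) :- con (+ 3) :* K := L) refl K L ⟩
    L ∎)
    where open ≡-Reasoning
  M≡ : M ≡ f₁ - f₀ - K - ((+ 1 / 2) * (f₂ - ι (+ 2) * f₁ + f₀) - ι (+ 3) * K)
  M≡ = trans (solve 4 (λ K L M N → M := (K :+ L :+ M :+ N) :- N :- K :- L) refl K L M N)
    (subst₂ (λ p q → (K + L + M + N) - N - K - L ≡ p - q - K - ((+ 1 / 2) * (f₂ - ι (+ 2) * f₁ + f₀) - ι (+ 3) * K))
      (sym f₁≡) (sym f₀≡) (cong (λ z → (K + L + M + N) - N - K - z) L≡))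
  N≡ : N ≡ f₀
  N≡ = sym f₀≡

-- Interpolation through six points

module Six (y₀ y₁ y₂ y₃ y₄ y₅ : ℤ) where

  r₀ r₁ r₂ : Row ℤ
  r₀ = differences (+ 0) y₀ y₁ y₂ y₃
  r₁ = differences (+ 1) y₁ y₂ y₃ y₄
  r₂ = differences (+ 2) y₂ y₃ y₄ y₅

  D β γ κ : ℚ
  D = ι (detₖ r₀ r₁ r₂)
  β = D ⁻¹ * ι (det-B r₀ r₁ r₂)
  γ = D ⁻¹ * ι (det-C r₀ r₁ r₂)
  -- The right-hand side of the equations is k = 6 K, hence the factor 1/6.
  κ = (+ 1 / 6) * (D ⁻¹ * ι (det r₀ r₁ r₂))

  interpolant : Cubic
  interpolant = completion β γ κ (ι y₀) (ι y₁) (ι y₂)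

  -- Either Cramer's rule applies, or a zero row forces K = 0, which no progression allows.
  Determined : Set
  Determined = detₖ r₀ r₁ r₂ ≢ 0ℤ ⊎ (Vanishing r₀ ⊎ Vanishing r₁ ⊎ Vanishing r₂)

  determined? : Dec Determined
  determined? = ¬? (detₖ r₀ r₁ r₂ ℤ.≟ 0ℤ) ⊎-dec (vanishing? r₀ ⊎-dec vanishing? r₁ ⊎-dec vanishing? r₂)

  module _ (c : Cubic)
    (h₀ : Through c (ι (+ 0)) (ι y₀)) (h₁ : Through c (ι (+ 1)) (ι y₁)) (h₂ : Through c (ι (+ 2)) (ι y₂))
    (h₃ : Through c (ι (+ 3)) (ι y₃)) (h₄ : Through c (ι (+ 4)) (ι y₄)) (h₅ : Through c (ι (+ 5)) (ι y₅))
    where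

    e₀ : Equation (A c) (B c) (C c) (ι (+ 6) * K c) (mapRow ι r₀)
    e₀ = ι-third-difference c (+ 0) y₀ y₁ y₂ y₃ h₀ h₁ h₂ h₃

    e₁ : Equation (A c) (B c) (C c) (ι (+ 6) * K c) (mapRow ι r₁)
    e₁ = ι-third-difference c (+ 1) y₁ y₂ y₃ y₄ h₁ h₂ h₃ h₄

    e₂ : Equation (A c) (B c) (C c) (ι (+ 6) * K c) (mapRow ι r₂)
    e₂ = ι-third-difference c (+ 2) y₂ y₃ y₄ y₅ h₂ h₃ h₄ h₅

    detₖ≢0 : ι (+ 6) * K c ≢ 0ℚ → Determined → detₖ r₀ r₁ r₂ ≢ 0ℤ
    detₖ≢0 6K≢0 (inj₁ det≢0)           = det≢0
    detₖ≢0 6K≢0 (inj₂ (inj₁ v))        = contradiction (vanishing⇒k≡0 r₀ v e₀) 6K≢0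
    detₖ≢0 6K≢0 (inj₂ (inj₂ (inj₁ v))) = contradiction (vanishing⇒k≡0 r₁ v e₁) 6K≢0
    detₖ≢0 6K≢0 (inj₂ (inj₂ (inj₂ v))) = contradiction (vanishing⇒k≡0 r₂ v e₂) 6K≢0

    interpolant-unique : A c ≡ 1ℚ → detₖ r₀ r₁ r₂ ≢ 0ℤ → c ≡ interpolant
    interpolant-unique A≡1 det≢0 = trans
      (completion-unique c (ι y₀) (ι y₁) (ι y₂) A≡1 h₀ h₁ h₂)
      (completion-cong B≡β C≡γ K≡κ)
      where
      completion-cong : ∀ {b c k} → b ≡ β → c ≡ γ → k ≡ κ →
                        completion b c k (ι y₀) (ι y₁) (ι y₂) ≡ interpolant
      completion-cong refl refl refl = refl

      drop-A : ∀ {p q} → A c * p ≡ q → p ≡ q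
      drop-A {p} eq = trans (sym (trans (cong (_* p) A≡1) (ℚ.*-identityˡ p))) eq

      B≡β : B c ≡ β
      B≡β = divide (ι-≢0 det≢0) (drop-A (ι-cramer-B r₀ r₁ r₂ e₀ e₁ e₂))

      C≡γ : C c ≡ γ
      C≡γ = divide (ι-≢0 det≢0) (drop-A (ι-cramer-C r₀ r₁ r₂ e₀ e₁ e₂))

      K≡κ : K c ≡ κ
      K≡κ = trans
        (sym (trans (sym (ℚ.*-assoc (+ 1 / 6) (ι (+ 6)) (K c))) (ℚ.*-identityˡ (K c))))
        (cong ((+ 1 / 6) *_) (divide {q = ι (+ 6) * K c} (ι-≢0 det≢0) (drop-A (ι-cramer-k r₀ r₁ r₂ e₀ e₁ e₂))))

interpolate : Vec ℤ 6 → WEq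
interpolate (y₀ ∷ y₁ ∷ y₂ ∷ y₃ ∷ y₄ ∷ y₅ ∷ []) = weierstrass (Six.interpolant y₀ y₁ y₂ y₃ y₄ y₅)

weierstrass≡interpolate : ∀ c y₀ y₁ y₂ y₃ y₄ y₅ →
  Through c (ι (+ 0)) (ι y₀) → Through c (ι (+ 1)) (ι y₁) → Through c (ι (+ 2)) (ι y₂) →
  Through c (ι (+ 3)) (ι y₃) → Through c (ι (+ 4)) (ι y₄) → Through c (ι (+ 5)) (ι y₅) →
  A c ≡ 1ℚ → (let open Six y₀ y₁ y₂ y₃ y₄ y₅) → detₖ r₀ r₁ r₂ ≢ 0ℤ →
  weierstrass c ≡ interpolate (y₀ ∷ y₁ ∷ y₂ ∷ y₃ ∷ y₄ ∷ y₅ ∷ [])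
weierstrass≡interpolate c y₀ y₁ y₂ y₃ y₄ y₅ h₀ h₁ h₂ h₃ h₄ h₅ A≡1 det≢0 =
  cong weierstrass (Six.interpolant-unique y₀ y₁ y₂ y₃ y₄ y₅ c h₀ h₁ h₂ h₃ h₄ h₅ A≡1 det≢0)

-- Pulling a Weierstrass equation back to the integer points

-- The coefficients obtained from X = x₀ + x d, Y = y₀ + y e.
pullback : WEq → ℚ → ℚ → ℚ → ℚ → Cubic
pullback (weq a₁ a₂ a₃ a₄ a₆) x₀ y₀ d e = cubic
  (e * e)
  (a₁ * (d * e))
  (e * (a₃ + x₀ * a₁ + ι (+ 2) * y₀))
  (d * d * d)
  (d * d * (a₂ + ι (+ 3) * x₀))
  (d * (a₄ + ι (+ 2) * x₀ * a₂ - y₀ * a₁ + ι (+ 3) * x₀ * x₀))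
  (a₆ + x₀ * a₄ + x₀ * x₀ * a₂ + x₀ * x₀ * x₀ - y₀ * a₃ - y₀ * y₀ - x₀ * y₀ * a₁)

-- As polynomials, `lhs` minus `rhs` is the defect of the Weierstrass equation at X = x₀ + x d, Y =
-- y₀ + y e.
through-pullback : ∀ E x₀ y₀ d e x y → OnCurve E (x₀ + x * d) (y₀ + y * e) →
                   Through (pullback E x₀ y₀ d e) x y
through-pullback (weq a₁ a₂ a₃ a₄ a₆) x₀ y₀ d e x y on = trans
  (solve 11 (λ a₁ a₂ a₃ a₄ a₆ x₀ y₀ d e x y →
    let X = x₀ :+ x :* d ; Y = y₀ :+ y :* e in
    (e :* e) :* (y :* y) :+ (a₁ :* (d :* e)) :* (x :* y) :+ (e :* (a₃ :+ x₀ :* a₁ :+ con (+ 2) :* y₀)) :* y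
    := ((d :* d :* d) :* (x :* x :* x) :+ (d :* d :* (a₂ :+ con (+ 3) :* x₀)) :* (x :* x)
         :+ (d :* (a₄ :+ con (+ 2) :* x₀ :* a₂ :- y₀ :* a₁ :+ con (+ 3) :* x₀ :* x₀)) :* x
         :+ (a₆ :+ x₀ :* a₄ :+ x₀ :* x₀ :* a₂ :+ x₀ :* x₀ :* x₀ :- y₀ :* a₃ :- y₀ :* y₀ :- x₀ :* y₀ :* a₁))
       :+ ((Y :* Y :+ a₁ :* X :* Y :+ a₃ :* Y) :- (X :* X :* X :+ a₂ :* X :* X :+ a₄ :* X :+ a₆)))
    refl a₁ a₂ a₃ a₄ a₆ x₀ y₀ d e x y)
  (trans (cong (λ z → rhs (pullback (weq a₁ a₂ a₃ a₄ a₆) x₀ y₀ d e) x y + z) (p≡q⇒p-q≡0 on)) (ℚ.+-identityʳ _))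

-- The change of variables is X = u² X′ + x₀, Y = u³ Y′ + y₀ with u = e/d; it
-- matches weierstrass because K/A = d³/e² = d/u² = e/u³.
isomorphic-pullback : ∀ E x₀ y₀ d e → d ≢ 0ℚ → e ≢ 0ℚ →
  Isomorphic E (weierstrass ((e * e) ⁻¹ • pullback E x₀ y₀ d e))
isomorphic-pullback (weq a₁ a₂ a₃ a₄ a₆) x₀ y₀ d e d≢0 e≢0 =
  e * i , x₀ , 0ℚ , y₀ , *-≢0 e≢0 i≢0
  -- Each of the five identities is first regrouped into powers of `j * (e * e)` and `i * d`;
  -- `units` then replaces both by 1.
  , trans (solve 5 (λ i j d e a → (e :* i) :* (j :* (a :* (d :* e))) := (j :* (e :* e)) :* (i :* d) :* a)
            refl i j d e a₁)
      (trans (units (λ p q → p * q * a₁))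
        (solve 1 (λ a₁ → con 1ℤ :* con 1ℤ :* a₁ := a₁ :+ con (+ 2) :* con 0ℤ) refl a₁))
  , trans (solve 5 (λ i j d e a → (e :* i) :* (e :* i) :* (j :* (d :* d :* a))
                      := (j :* (e :* e)) :* ((i :* d) :* (i :* d)) :* a)
            refl i j d e (a₂ + ι (+ 3) * x₀))
      (trans (units (λ p q → p * (q * q) * (a₂ + ι (+ 3) * x₀)))
        (solve 3 (λ a₁ a₂ x₀ → con 1ℤ :* (con 1ℤ :* con 1ℤ) :* (a₂ :+ con (+ 3) :* x₀)
                      := a₂ :- con 0ℤ :* a₁ :+ con (+ 3) :* x₀ :- con 0ℤ :* con 0ℤ) refl a₁ a₂ x₀))
  , trans (solve 5 (λ i j d e a → (e :* i) :* (e :* i) :* (e :* i) :* ((j :* (e :* a)) :* (j :* (d :* d :* d)))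
                      := ((j :* (e :* e)) :* (j :* (e :* e))) :* ((i :* d) :* (i :* d) :* (i :* d)) :* a)
            refl i j d e (a₃ + x₀ * a₁ + ι (+ 2) * y₀))
      (trans (units (λ p q → (p * p) * (q * q * q) * (a₃ + x₀ * a₁ + ι (+ 2) * y₀)))
        (ℚ.*-identityˡ _))
  , trans (solve 5 (λ i j d e a →
                      (e :* i) :* (e :* i) :* (e :* i) :* (e :* i) :* ((j :* (d :* a)) :* (j :* (d :* d :* d)))
                      := ((j :* (e :* e)) :* (j :* (e :* e)))
                         :* ((i :* d) :* (i :* d) :* (i :* d) :* (i :* d)) :* a)
            refl i j d e (a₄ + ι (+ 2) * x₀ * a₂ - y₀ * a₁ + ι (+ 3) * x₀ * x₀))
      (trans (units (λ p q → (p * p) * (q * q * q * q) * (a₄ + ι (+ 2) * x₀ * a₂ - y₀ * a₁ + ι (+ 3) * x₀ * x₀)))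
        (solve 6 (λ a₁ a₂ a₃ a₄ x₀ y₀ →
          con 1ℤ :* (a₄ :+ con (+ 2) :* x₀ :* a₂ :- y₀ :* a₁ :+ con (+ 3) :* x₀ :* x₀)
          := a₄ :- con 0ℤ :* a₃ :+ con (+ 2) :* x₀ :* a₂ :- (y₀ :+ x₀ :* con 0ℤ) :* a₁
             :+ con (+ 3) :* x₀ :* x₀ :- con (+ 2) :* con 0ℤ :* y₀) refl a₁ a₂ a₃ a₄ x₀ y₀))
  , trans (solve 5 (λ i j d e a →
                      (e :* i) :* (e :* i) :* (e :* i) :* (e :* i) :* (e :* i) :* (e :* i)
                         :* ((j :* a) :* ((j :* (d :* d :* d)) :* (j :* (d :* d :* d))))
                      := ((j :* (e :* e)) :* (j :* (e :* e)) :* (j :* (e :* e)))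
                         :* ((i :* d) :* (i :* d) :* (i :* d) :* (i :* d) :* (i :* d) :* (i :* d)) :* a)
            refl i j d e (N (pullback (weq a₁ a₂ a₃ a₄ a₆) x₀ y₀ d e)))
      (trans (units (λ p q → (p * p * p) * (q * q * q * q * q * q) * N (pullback (weq a₁ a₂ a₃ a₄ a₆) x₀ y₀ d e)))
        (ℚ.*-identityˡ _))
  where
  i = d ⁻¹
  j = (e * e) ⁻¹
  i*d≡1 = ⁻¹-inverseˡ d≢0
  i≢0 : i ≢ 0ℚ
  i≢0 i≡0 = contradiction (trans (sym i*d≡1) (trans (cong (_* d) i≡0) (ℚ.*-zeroˡ d))) λ ()
  units : (f : ℚ → ℚ → ℚ) → f (j * (e * e)) (i * d) ≡ f 1ℚ 1ℚ
  units f = cong₂ f (⁻¹-inverseˡ (*-≢0 e≢0 e≢0)) i*d≡1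

-- Simultaneous arithmetic progressions

values : ℕ → List ℤ
values n = map +_ (upTo n)

record Fit (E : WEq) (n : ℕ) : Set where
  field
    x₀ y₀ d e : ℚ
    d≢0       : d ≢ 0ℚ
    τ         : Fin n → ℤ
    τ∈        : tabulate τ ∈ arrangements ℤ._≟_ n (values n)

  curve : Cubic
  curve = pullback E x₀ y₀ d e

  field
    through : ∀ i → Through curve (idx i) (ι (τ i))

  6K≢0 : ι (+ 6) * K curve ≢ 0ℚ
  6K≢0 = *-≢0 {ι (+ 6)} (λ ()) (*-≢0 (*-≢0 d≢0 d≢0) d≢0)

sap⇒fit : ∀ {E n} → HasSAP E n → Fit E (suc n)
sap⇒fit {E} {n} (xs , ys , on , (x₀ , d , d≢0 , xs≡) , (σ , y₀ , e , ys≡)) = record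
  { x₀ = x₀ ; y₀ = y₀ ; d = d ; e = e ; d≢0 = d≢0
  -- The ordinates satisfy y_σ(i) = y₀ + i e, so the point with abscissa index i carries the inverse
  -- image of i under σ.
  ; τ  = λ i → + toℕ (σ ⟨$⟩ˡ i)
  ; τ∈ = ∈-arrangements ℤ._≟_ (suc n) _
           (λ eq → trans (sym (inverseʳ σ)) (trans (cong (σ ⟨$⟩ʳ_) (toℕ-injective (ℤ.+-injective eq))) (inverseʳ σ)))
           (λ i → ∈-map⁺ +_ (∈-upTo⁺ (toℕ<n (σ ⟨$⟩ˡ i))))
  ; through = λ i → through-pullback E x₀ y₀ d e (idx i) (idx (σ ⟨$⟩ˡ i))
      (subst₂ (OnCurve E) (xs≡ i) (trans (cong ys (sym (inverseʳ σ))) (ys≡ (σ ⟨$⟩ˡ i))) (on i))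
  }

-- For e = 0 the pullback has A = B = C = 0, but K = d³ ≠ 0.
equation⇒e≢0 : ∀ E x₀ y₀ d e r → let c = pullback E x₀ y₀ d e in
  ι (+ 6) * K c ≢ 0ℚ → Equation (A c) (B c) (C c) (ι (+ 6) * K c) r → e ≢ 0ℚ
equation⇒e≢0 (weq a₁ a₂ a₃ a₄ a₆) x₀ y₀ d e (row P Q R) 6K≢0 (equation eq) refl = 6K≢0 (trans (sym eq)
  (solve 6 (λ a d b P Q R →
     (con 0ℤ :* con 0ℤ) :* P :+ (a :* (d :* con 0ℤ)) :* Q :+ (con 0ℤ :* b) :* R := con 0ℤ)
     refl a₁ d (a₃ + x₀ * a₁ + ι (+ 2) * y₀) P Q R))

-- Progressions of length seven

Obstructed₇ : Vec ℤ 7 → Set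
Obstructed₇ (y₀ ∷ y₁ ∷ y₂ ∷ y₃ ∷ y₄ ∷ y₅ ∷ y₆ ∷ []) =
  Obstructed (differences (+ 0) y₀ y₁ y₂ y₃) (differences (+ 1) y₁ y₂ y₃ y₄)
             (differences (+ 2) y₂ y₃ y₄ y₅) (differences (+ 3) y₃ y₄ y₅ y₆)

obstructed₇? : ∀ ys → Dec (Obstructed₇ ys)
obstructed₇? (y₀ ∷ y₁ ∷ y₂ ∷ y₃ ∷ y₄ ∷ y₅ ∷ y₆ ∷ []) = obstructed? _ _ _ _

-- Proved by evaluating the decision procedure on all 5040 arrangements in integer arithmetic.
all-obstructed₇ : All Obstructed₇ (arrangements ℤ._≟_ 7 (values 7))
all-obstructed₇ = toWitness {a? = all? obstructed₇? (arrangements ℤ._≟_ 7 (values 7))} _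

no-fit₇ : ∀ {E} → ¬ Fit E 7
no-fit₇ {E} fit = ¬obstructed (*-≢0 e≢0 e≢0) 6K≢0
  (differences (+ 0) (τ 0F) (τ 1F) (τ 2F) (τ 3F)) (differences (+ 1) (τ 1F) (τ 2F) (τ 3F) (τ 4F))
  (differences (+ 2) (τ 2F) (τ 3F) (τ 4F) (τ 5F)) (differences (+ 3) (τ 3F) (τ 4F) (τ 5F) (τ 6F))
  e₀ e₁ e₂ e₃ (All.lookup all-obstructed₇ τ∈)
  where
  open Fit fit
  e₀ = ι-third-difference curve (+ 0) (τ 0F) (τ 1F) (τ 2F) (τ 3F) (through 0F) (through 1F) (through 2F) (through 3F)
  e₁ = ι-third-difference curve (+ 1) (τ 1F) (τ 2F) (τ 3F) (τ 4F) (through 1F) (through 2F) (through 3F) (through 4F)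
  e₂ = ι-third-difference curve (+ 2) (τ 2F) (τ 3F) (τ 4F) (τ 5F) (through 2F) (through 3F) (through 4F) (through 5F)
  e₃ = ι-third-difference curve (+ 3) (τ 3F) (τ 4F) (τ 5F) (τ 6F) (through 3F) (through 4F) (through 5F) (through 6F)
  e≢0 = equation⇒e≢0 E x₀ y₀ d e (mapRow ι (differences (+ 0) (τ 0F) (τ 1F) (τ 2F) (τ 3F))) 6K≢0 e₀

-- Progressions of length six

Determined : Vec ℤ 6 → Set
Determined (y₀ ∷ y₁ ∷ y₂ ∷ y₃ ∷ y₄ ∷ y₅ ∷ []) = Six.Determined y₀ y₁ y₂ y₃ y₄ y₅

determined? : ∀ ys → Dec (Determined ys)
determined? (y₀ ∷ y₁ ∷ y₂ ∷ y₃ ∷ y₄ ∷ y₅ ∷ []) = Six.determined? y₀ y₁ y₂ y₃ y₄ y₅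

all-determined : All Determined (arrangements ℤ._≟_ 6 (values 6))
all-determined = toWitness {a? = all? determined? (arrangements ℤ._≟_ 6 (values 6))} _

-- Scaling the pullback by the inverse of e² makes A = 1; uniqueness of the interpolant then
-- identifies the isomorphic curve.
fit₆⇒isomorphic : ∀ {E} (fit : Fit E 6) → Isomorphic E (interpolate (tabulate (Fit.τ fit)))
fit₆⇒isomorphic {E} fit = subst (Isomorphic E)
  (weierstrass≡interpolate ((e * e) ⁻¹ • curve) (τ 0F) (τ 1F) (τ 2F) (τ 3F) (τ 4F) (τ 5F)
    (scaled 0F) (scaled 1F) (scaled 2F) (scaled 3F) (scaled 4F) (scaled 5F)
    (⁻¹-inverseˡ (*-≢0 e≢0 e≢0)) det≢0)
  (isomorphic-pullback E x₀ y₀ d e d≢0 e≢0)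
  where
  open Fit fit
  module S = Six (τ 0F) (τ 1F) (τ 2F) (τ 3F) (τ 4F) (τ 5F)

  scaled : ∀ i → Through ((e * e) ⁻¹ • curve) (idx i) (ι (τ i))
  scaled i = through-• ((e * e) ⁻¹) curve (through i)

  e≢0 : e ≢ 0ℚ
  e≢0 = equation⇒e≢0 E x₀ y₀ d e (mapRow ι S.r₀) 6K≢0
    (S.e₀ curve (through 0F) (through 1F) (through 2F) (through 3F) (through 4F) (through 5F))

  det≢0 : detₖ S.r₀ S.r₁ S.r₂ ≢ 0ℤ
  det≢0 = S.detₖ≢0 curve (through 0F) (through 1F) (through 2F) (through 3F) (through 4F) (through 5F)
    6K≢0 (All.lookup all-determined τ∈)

-- One candidate per arrangement. Where `detₖ` is zero the entry is an artefact of the default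
-- inverse, which does no harm: the list only has to cover all isomorphism classes.
curves₆ : List WEq
curves₆ = map interpolate (arrangements ℤ._≟_ 6 (values 6))

fit₆⇒∈curves₆ : ∀ {E} (fit : Fit E 6) → interpolate (tabulate (Fit.τ fit)) ∈ curves₆
fit₆⇒∈curves₆ fit = ∈-map⁺ interpolate (Fit.τ∈ fit)

theorem3 : ((E : WEq) → Nonsingular E → ¬ HasSAP E 6)
    × (Σ (List WEq) λ Es → (E : WEq) → Nonsingular E → HasSAP E 5 →
    Σ WEq λ E' → (E' ∈ Es) × Isomorphic E E')
theorem3 = (λ E _ sap → no-fit₇ (sap⇒fit {E} sap)) , curves₆ , λ E _ sap →
  let fit = sap⇒fit {E} sap in
  interpolate (tabulate (Fit.τ fit)) , fit₆⇒∈curves₆ fit , fit₆⇒isomorphic fit
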